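{- Let $R$ be a Dedekind domain and let $I$ be a nonzero ideal of $R$ such that $R/I$ is finite and nontrivial. Let $m$ be a positive integer and suppose $I$ has exactly $m$ distinct prime ideal divisors $P$ with $|R/P|=2$. Then $G_{R/I}$ has exactly $2^{m-1}$ connected components, and these components are bipartite graphs, pairwise isomorphic, each of diameter at most $3$.
   Context: $G_{R/I}$ is the unitary Cayley graph of $R/I$: vertex set $R/I$, with $a+I$, $b+I$ adjacent iff $a-b+I$ is a unit of $R/I$. -}

module Defs where

open import Level using (Level; _⊔_) renaming (suc to lsuc)
open import Algebra.Bundles using (CommutativeRing)
open import Data.Nat as ℕ using (ℕ; _≥_)
open import Data.Fin using (Fin; toℕ)
open import Data.Bool using (Bool)
open import Data.Product using (Σ; ∃; _×_; _,_)
open import Data.Sum using (_⊎_)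
open import Relation.Nullary using (¬_)
open import Relation.Binary.PropositionalEquality using (_≡_; _≢_)

module _ {c ℓ : Level} (R : CommutativeRing c ℓ) where
  open CommutativeRing R

  sub : Carrier → Carrier → Carrier
  sub x y = x + (- y)

  pow : Carrier → ℕ → Carrier
  pow x ℕ.zero = 1#
  pow x (ℕ.suc n) = x * pow x n

  sumF : (n : ℕ) → (Fin n → Carrier) → Carrier
  sumF ℕ.zero f = 0#
  sumF (ℕ.suc n) f = f Fin.zero + sumF n (λ i → f (Fin.suc i))

  record Ideal : Set (lsuc (c ⊔ ℓ)) where
    field
      mem  : Carrier → Set (c ⊔ ℓ)
      resp : ∀ {x y} → x ≈ y → mem x → mem y
      0∈   : mem 0#
      +∈   : ∀ {x y} → mem x → mem y → mem (x + y)
      *∈   : ∀ r {x} → mem x → mem (r * x)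

  _∈_ : Carrier → Ideal → Set (c ⊔ ℓ)
  x ∈ I = Ideal.mem I x

  _⊆_ : Ideal → Ideal → Set (c ⊔ ℓ)
  I ⊆ J = ∀ x → x ∈ I → x ∈ J

  SameIdeal : Ideal → Ideal → Set (c ⊔ ℓ)
  SameIdeal I J = (I ⊆ J) × (J ⊆ I)

  NonzeroIdeal : Ideal → Set (c ⊔ ℓ)
  NonzeroIdeal I = ∃ λ x → (x ∈ I) × ¬ (x ≈ 0#)

  ProperIdeal : Ideal → Set (c ⊔ ℓ)
  ProperIdeal I = ¬ (1# ∈ I)

  IsPrimeIdeal : Ideal → Set (c ⊔ ℓ)
  IsPrimeIdeal P = ProperIdeal P × (∀ x y → (x * y) ∈ P → (x ∈ P) ⊎ (y ∈ P))

  IsMaximalIdeal : Ideal → Set (lsuc (c ⊔ ℓ))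
  IsMaximalIdeal M = ProperIdeal M × (∀ J → M ⊆ J → (J ⊆ M) ⊎ (1# ∈ J))

  Divides : Carrier → Carrier → Set (c ⊔ ℓ)
  Divides a b = ∃ λ q → (q * a) ≈ b

  InProduct : Ideal → Ideal → Carrier → Set (c ⊔ ℓ)
  InProduct P J x =
    ∃ λ n → Σ (Fin n → Carrier) λ p → Σ (Fin n → Carrier) λ q →
      (∀ i → p i ∈ P) × (∀ i → q i ∈ J) × (x ≈ sumF n (λ i → p i * q i))

  IdealDivides : Ideal → Ideal → Set (lsuc (c ⊔ ℓ))
  IdealDivides P I = ∃ λ J → ∀ x → ((x ∈ I) → InProduct P J x) × (InProduct P J x → x ∈ I)

  IsIntegralDomain : Set (c ⊔ ℓ)
  IsIntegralDomain = ¬ (1# ≈ 0#) × (∀ x y → (x * y) ≈ 0# → (x ≈ 0#) ⊎ (y ≈ 0#))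

  IsNoetherian : Set (lsuc (c ⊔ ℓ))
  IsNoetherian = ∀ (chain : ℕ → Ideal) → (∀ n → chain n ⊆ chain (ℕ.suc n)) →
                 ∃ λ N → ∀ n → n ≥ N → chain n ⊆ chain N

  -- integrally closed in its field of fractions: if a/b (b ≠ 0) is a root of a
  -- monic polynomial x^n + Σ_{i<n} c_i x^i over R, then b ∣ a.  (Cleared of
  -- denominators: a^n + Σ_{i<n} c_i a^i b^(n-i) = 0.)
  IsIntegrallyClosed : Set (c ⊔ ℓ)
  IsIntegrallyClosed = ∀ a b → ¬ (b ≈ 0#) → ∀ n (cs : Fin n → Carrier) →
    (pow a n + sumF n (λ i → cs i * (pow a (toℕ i) * pow b (n ℕ.∸ toℕ i)))) ≈ 0# →
    Divides b a

  IsDedekindDomain : Set (lsuc (c ⊔ ℓ))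
  IsDedekindDomain = IsIntegralDomain × IsNoetherian × IsIntegrallyClosed ×
    (∀ P → IsPrimeIdeal P → NonzeroIdeal P → IsMaximalIdeal P)

  -- the quotient R/I, represented by elements of R modulo  x ≋ y ⇔ x - y ∈ I
  _≋[_]_ : Carrier → Ideal → Carrier → Set (c ⊔ ℓ)
  x ≋[ I ] y = sub x y ∈ I

  QuotientFinite : Ideal → Set (c ⊔ ℓ)
  QuotientFinite I = ∃ λ n → Σ (Fin n → Carrier) λ f → ∀ x → ∃ λ i → x ≋[ I ] f i

  QuotientNontrivial : Ideal → Set (c ⊔ ℓ)
  QuotientNontrivial I = ¬ (1# ≋[ I ] 0#)

  QuotientCard : Ideal → ℕ → Set (c ⊔ ℓ)
  QuotientCard I k = Σ (Fin k → Carrier) λ f →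
    (∀ x → ∃ λ i → x ≋[ I ] f i) × (∀ i j → f i ≋[ I ] f j → i ≡ j)

  ExactlyTwoPrimeDivisors : Ideal → ℕ → Set (lsuc (c ⊔ ℓ))
  ExactlyTwoPrimeDivisors I m = Σ (Fin m → Ideal) λ Ps →
    (∀ i → IsPrimeIdeal (Ps i) × IdealDivides (Ps i) I × QuotientCard (Ps i) 2) ×
    (∀ i j → SameIdeal (Ps i) (Ps j) → i ≡ j) ×
    (∀ P → IsPrimeIdeal P → IdealDivides P I → QuotientCard P 2 → ∃ λ i → SameIdeal P (Ps i))

  -- the unitary Cayley graph G_{R/I}: vertices R/I, a ~ b iff a - b is a unit of R/I
  Adj : Ideal → Carrier → Carrier → Set (c ⊔ ℓ)
  Adj I a b = ∃ λ u → (sub a b * u) ≋[ I ] 1#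

  data Reach (I : Ideal) : Carrier → Carrier → Set (c ⊔ ℓ) where
    here : ∀ {a b} → a ≋[ I ] b → Reach I a b
    step : ∀ {a b d} → Adj I a b → Reach I b d → Reach I a d

  WalkWithin : Ideal → ℕ → Carrier → Carrier → Set (c ⊔ ℓ)
  WalkWithin I ℕ.zero a b = a ≋[ I ] b
  WalkWithin I (ℕ.suc n) a b = (a ≋[ I ] b) ⊎ (∃ λ d → Adj I a d × WalkWithin I n d b)

  BipartiteComp : Ideal → Carrier → Set (c ⊔ ℓ)
  BipartiteComp I r = Σ (Carrier → Bool) λ col →
    (∀ a b → Reach I r a → Reach I r b → a ≋[ I ] b → col a ≡ col b) ×
    (∀ a b → Reach I r a → Reach I r b → Adj I a b → col a ≢ col b)

  CompIso : Ideal → Carrier → Carrier → Set (c ⊔ ℓ)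
  CompIso I r s = Σ (Carrier → Carrier) λ f → Σ (Carrier → Carrier) λ g →
    (∀ a → Reach I r a → Reach I s (f a)) ×
    (∀ b → Reach I s b → Reach I r (g b)) ×
    (∀ a a' → Reach I r a → Reach I r a' → a ≋[ I ] a' → f a ≋[ I ] f a') ×
    (∀ b b' → Reach I s b → Reach I s b' → b ≋[ I ] b' → g b ≋[ I ] g b') ×
    (∀ a → Reach I r a → g (f a) ≋[ I ] a) ×
    (∀ b → Reach I s b → f (g b) ≋[ I ] b) ×
    (∀ a a' → Reach I r a → Reach I r a' → (Adj I a a' → Adj I (f a) (f a')) × (Adj I (f a) (f a') → Adj I a a'))

  DiameterAtMost : Ideal → Carrier → ℕ → Set (c ⊔ ℓ)
  DiameterAtMost I r k = ∀ a b → Reach I r a → Reach I r b → WalkWithin I k a b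

{-# OPTIONS --safe #-}
-- Let P₀, …, P₍ₘ₋₁₎ be the prime divisors of I with residue field of two elements.
-- Adjacent a, b satisfy a - b ∉ Pᵢ for every i, so along a walk the difference of the
-- end points lies either in all Pᵢ ("even") or in none ("odd").  Conversely an even x
-- is a sum of two units of R/I: modulo a prime M ⊇ I there is z with z ≢ 0 and z ≢ x,
-- unless R/M has two elements and x ∉ M, and such local choices glue along idempotents
-- of the finite ring R/I.  Hence an even difference is joined by a walk of length 2 and an
-- odd one by a walk of length 3, so components are the classes of "even or odd difference",
-- and the Chinese remainder theorem counts them.  The list P₀, …, P₍ₘ₋₁₎ contains every prime
-- M ⊇ I with |R/M| = 2 because containing I implies dividing I in a Dedekind domain.
--
-- The case distinctions are classical; excluded middle is available because maximality
-- of a nonzero prime is given as a disjunction for every larger ideal.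
module Submission where

open import Defs
open import Level using (Level; _⊔_; Lift; lift)
open import Algebra.Bundles using (CommutativeRing)
open import Algebra.Solver.Ring.AlmostCommutativeRing
  using (fromCommutativeRing; _-Raw-AlmostCommutative⟶_)
import Algebra.Solver.Ring
import Algebra.Properties.Ring
import Algebra.Properties.Semiring.Mult.TCOptimised
import Relation.Binary.Reasoning.Setoid
open import Data.Bool using (Bool)
open import Data.Nat as ℕ using (ℕ; _^_; _∸_; _≤_)
import Data.Nat.Properties as ℕ
open import Data.Integer as ℤ using (ℤ; +_; -[1+_])
import Data.Integer.Properties as ℤ
open import Data.Fin using (Fin; toℕ; combine; finToFun; funToFin)
import Data.Fin.Properties as Fin
open import Data.List using (List; []; _∷_)
open import Data.Maybe using (Maybe; just; nothing)
open import Data.Product using (Σ; ∃; _×_; _,_; proj₁; proj₂)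
open import Data.Sum using (_⊎_; inj₁; inj₂; [_,_]′)
open import Data.Empty using (⊥-elim)
open import Function using (_∘_)
open import Relation.Nullary using (¬_; Dec; yes; no; does; contradiction)
open import Relation.Binary.PropositionalEquality as ≡ using (_≡_; _≢_; _≗_)

-- Polynomial identities in a commutative ring, with integer coefficients

module IntegerSolver {c ℓ : Level} (R : CommutativeRing c ℓ) where
  open CommutativeRing R
  open Algebra.Properties.Ring ring
    using (-0#≈0#; -‿involutive; -‿distribˡ-*; -‿distribʳ-*; -‿+-comm)
  open Algebra.Properties.Semiring.Mult.TCOptimised semiring
    using (1+×; ×-homo-+; ×1-homo-*) renaming (_×_ to _·_)
  open Relation.Binary.Reasoning.Setoid setoid

  private
    ⟦_⟧ : ℤ → Carrier
    ⟦ + n ⟧      = n · 1#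
    ⟦ -[1+ n ] ⟧ = - (ℕ.suc n · 1#)

    cancel-1 : ∀ x y → x + - y ≈ (1# + x) + - (1# + y)
    cancel-1 x y = sym (begin
      (1# + x) + - (1# + y)      ≈⟨ +-cong (+-comm 1# x) (sym (-‿+-comm 1# y)) ⟩
      (x + 1#) + (- 1# + - y)    ≈⟨ +-assoc x 1# _ ⟩
      x + (1# + (- 1# + - y))    ≈⟨ +-congˡ (sym (+-assoc 1# (- 1#) (- y))) ⟩
      x + ((1# + - 1#) + - y)    ≈⟨ +-congˡ (+-congʳ (-‿inverseʳ 1#)) ⟩
      x + (0# + - y)             ≈⟨ +-congˡ (+-identityˡ (- y)) ⟩
      x + - y                    ∎)

    ⟦⟧-⊖ : ∀ m n → ⟦ m ℤ.⊖ n ⟧ ≈ m · 1# + - (n · 1#)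
    ⟦⟧-⊖ m ℕ.zero = sym (trans (+-congˡ -0#≈0#) (+-identityʳ _))
    ⟦⟧-⊖ ℕ.zero (ℕ.suc n) = sym (+-identityˡ _)
    ⟦⟧-⊖ (ℕ.suc m) (ℕ.suc n) rewrite ℤ.[1+m]⊖[1+n]≡m⊖n m n = begin
      ⟦ m ℤ.⊖ n ⟧                           ≈⟨ ⟦⟧-⊖ m n ⟩
      m · 1# + - (n · 1#)                   ≈⟨ cancel-1 _ _ ⟩
      (1# + m · 1#) + - (1# + n · 1#)
        ≈⟨ +-cong (1+× m 1#) (-‿cong (1+× n 1#)) ⟨
      ℕ.suc m · 1# + - (ℕ.suc n · 1#)       ∎

    ⟦⟧-+ : ∀ i j → ⟦ i ℤ.+ j ⟧ ≈ ⟦ i ⟧ + ⟦ j ⟧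
    ⟦⟧-+ (+ m)    (+ n)    = ×-homo-+ 1# m n
    ⟦⟧-+ (+ m)    -[1+ n ] = ⟦⟧-⊖ m (ℕ.suc n)
    ⟦⟧-+ -[1+ m ] (+ n)    = trans (⟦⟧-⊖ n (ℕ.suc m)) (+-comm _ _)
    ⟦⟧-+ -[1+ m ] -[1+ n ] = begin
      - (ℕ.suc (ℕ.suc (m ℕ.+ n)) · 1#)
        ≡⟨ ≡.cong (λ k → - (ℕ.suc k · 1#)) (≡.sym (ℕ.+-suc m n)) ⟩
      - ((ℕ.suc m ℕ.+ ℕ.suc n) · 1#)           ≈⟨ -‿cong (×-homo-+ 1# (ℕ.suc m) (ℕ.suc n)) ⟩
      - (ℕ.suc m · 1# + ℕ.suc n · 1#)          ≈⟨ -‿+-comm _ _ ⟨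
      - (ℕ.suc m · 1#) + - (ℕ.suc n · 1#)      ∎

    ⟦⟧-neg : ∀ i → ⟦ ℤ.- i ⟧ ≈ - ⟦ i ⟧
    ⟦⟧-neg (+ ℕ.zero)    = sym -0#≈0#
    ⟦⟧-neg (+ (ℕ.suc n)) = refl
    ⟦⟧-neg -[1+ n ]      = sym (-‿involutive _)

    ⟦⟧-*-pos : ∀ m n → ⟦ + m ℤ.* + n ⟧ ≈ ⟦ + m ⟧ * ⟦ + n ⟧
    ⟦⟧-*-pos m n rewrite ≡.sym (ℤ.pos-* m n) = ×1-homo-* m n

    ⟦⟧-*-posʳ : ∀ i n → ⟦ i ℤ.* + n ⟧ ≈ ⟦ i ⟧ * ⟦ + n ⟧
    ⟦⟧-*-posʳ (+ m) n = ⟦⟧-*-pos m n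
    ⟦⟧-*-posʳ -[1+ m ] n rewrite ≡.sym (ℤ.neg-distribˡ-* (+ ℕ.suc m) (+ n)) = begin
      ⟦ ℤ.- (+ ℕ.suc m ℤ.* + n) ⟧  ≈⟨ ⟦⟧-neg (+ ℕ.suc m ℤ.* + n) ⟩
      - ⟦ + ℕ.suc m ℤ.* + n ⟧      ≈⟨ -‿cong (⟦⟧-*-pos (ℕ.suc m) n) ⟩
      - (⟦ + ℕ.suc m ⟧ * ⟦ + n ⟧)  ≈⟨ -‿distribˡ-* _ _ ⟩
      - ⟦ + ℕ.suc m ⟧ * ⟦ + n ⟧    ∎

    ⟦⟧-* : ∀ i j → ⟦ i ℤ.* j ⟧ ≈ ⟦ i ⟧ * ⟦ j ⟧
    ⟦⟧-* i (+ n) = ⟦⟧-*-posʳ i n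
    ⟦⟧-* i -[1+ n ] rewrite ≡.sym (ℤ.neg-distribʳ-* i (+ ℕ.suc n)) = begin
      ⟦ ℤ.- (i ℤ.* + ℕ.suc n) ⟧    ≈⟨ ⟦⟧-neg (i ℤ.* + ℕ.suc n) ⟩
      - ⟦ i ℤ.* + ℕ.suc n ⟧        ≈⟨ -‿cong (⟦⟧-*-posʳ i (ℕ.suc n)) ⟩
      - (⟦ i ⟧ * ⟦ + ℕ.suc n ⟧)    ≈⟨ -‿distribʳ-* _ _ ⟩
      ⟦ i ⟧ * - ⟦ + ℕ.suc n ⟧      ∎

    ℤ⟶R : CommutativeRing.rawRing ℤ.+-*-commutativeRing
            -Raw-AlmostCommutative⟶ fromCommutativeRing R
    ℤ⟶R = record
      { ⟦_⟧ = ⟦_⟧ ; +-homo = ⟦⟧-+ ; *-homo = ⟦⟧-* ; -‿homo = ⟦⟧-neg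
      ; 0-homo = refl ; 1-homo = refl }

    -- Distinct integers may have equal images in `R`; `nothing` only declines to identify them, so
    -- comparing the integers themselves is sound.
    _coeff≟_ : ∀ i j → Maybe (⟦ i ⟧ ≈ ⟦ j ⟧)
    i coeff≟ j with i ℤ.≟ j
    ... | yes ≡.refl = just refl
    ... | no _       = nothing

  open Algebra.Solver.Ring _ _ ℤ⟶R _coeff≟_ public
    using (solve; Polynomial; con; _:=_; _:+_; _:*_; _:-_; :-_)

  :1 :0 : ∀ {n} → Polynomial n
  :1 = con (+ 1)
  :0 = con (+ 0)

-- Ideals, congruences and finite sums

module IdealTheory {c ℓ : Level} (R : CommutativeRing c ℓ) where
  open CommutativeRing R hiding (zero)
  open IntegerSolver R
  open Ideal
  open Relation.Binary.Reasoning.Setoid setoid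

  infix 4 _⊑_
  _⊑_ : Ideal R → Ideal R → Set (c ⊔ ℓ)
  _⊑_ = _⊆_ R

  neg∈ : ∀ (I : Ideal R) {x} → mem I x → mem I (- x)
  neg∈ I {x} p = resp I (solve 1 (λ x → (:- :1) :* x := :- x) refl x) (*∈ I (- 1#) p)

  sub∈ : ∀ (I : Ideal R) {x y} → mem I x → mem I y → mem I (x - y)
  sub∈ I p q = +∈ I p (neg∈ I q)

  ∈-of-sub∈ : ∀ (I : Ideal R) {x y} → mem I (x - y) → mem I y → mem I x
  ∈-of-sub∈ I {x} {y} p q =
    resp I (solve 2 (λ x y → (x :- y) :+ y := x) refl x y) (+∈ I p q)

  ≋-refl : ∀ (I : Ideal R) {x} → mem I (x - x)
  ≋-refl I {x} = resp I (sym (-‿inverseʳ x)) (0∈ I)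

  ≋-sym : ∀ (I : Ideal R) {x y} → mem I (x - y) → mem I (y - x)
  ≋-sym I {x} {y} p =
    resp I (solve 2 (λ x y → :- (x :- y) := y :- x) refl x y) (neg∈ I p)

  ≋-trans : ∀ (I : Ideal R) {x y z} → mem I (x - y) → mem I (y - z) → mem I (x - z)
  ≋-trans I {x} {y} {z} p q =
    resp I (solve 3 (λ x y z → (x :- y) :+ (y :- z) := x :- z) refl x y z) (+∈ I p q)

  ≋-*ˡ : ∀ (I : Ideal R) r {x y} → mem I (x - y) → mem I (r * x - r * y)
  ≋-*ˡ I r {x} {y} p =
    resp I (solve 3 (λ r x y → r :* (x :- y) := r :* x :- r :* y) refl r x y) (*∈ I r p)

  ≈⇒≋ : ∀ (I : Ideal R) {x y} → x ≈ y → mem I (x - y)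
  ≈⇒≋ I {x} {y} eq = resp I (+-congˡ (-‿cong eq)) (≋-refl I)

  sumF-cong : ∀ n {f g : Fin n → Carrier} → (∀ i → f i ≈ g i) → sumF R n f ≈ sumF R n g
  sumF-cong ℕ.zero    eq = refl
  sumF-cong (ℕ.suc n) eq = +-cong (eq Fin.zero) (sumF-cong n (eq ∘ Fin.suc))

  *-distribˡ-sumF : ∀ r n (f : Fin n → Carrier) → r * sumF R n f ≈ sumF R n (λ i → r * f i)
  *-distribˡ-sumF r ℕ.zero    f = zeroʳ r
  *-distribˡ-sumF r (ℕ.suc n) f =
    trans (distribˡ r _ _) (+-congˡ (*-distribˡ-sumF r n (f ∘ Fin.suc)))

  sumF∈ : ∀ (I : Ideal R) n {f : Fin n → Carrier} → (∀ i → mem I (f i)) → mem I (sumF R n f)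
  sumF∈ I ℕ.zero    p = 0∈ I
  sumF∈ I (ℕ.suc n) p = +∈ I (p Fin.zero) (sumF∈ I n (p ∘ Fin.suc))

  sumF-single : ∀ (I : Ideal R) n (f : Fin n → Carrier) i →
    (∀ j → j ≢ i → mem I (f j)) → mem I (sumF R n f - f i)
  sumF-single I (ℕ.suc n) f Fin.zero h =
    resp I (solve 2 (λ s x → s := (x :+ s) :- x) refl _ _)
      (sumF∈ I n (λ j → h (Fin.suc j) λ ()))
  sumF-single I (ℕ.suc n) f (Fin.suc i) h =
    resp I (solve 3 (λ x s t → x :+ (s :- t) := (x :+ s) :- t) refl _ _ _)
      (+∈ I (h Fin.zero λ ())
            (sumF-single I n (f ∘ Fin.suc) i
              λ j j≢i → h (Fin.suc j) (j≢i ∘ Fin.suc-injective)))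

  pow∉ : ∀ M {x} → IsPrimeIdeal R M → ¬ mem M x → ∀ n → ¬ mem M (pow R x n)
  pow∉ M (proper , _)        x∉M ℕ.zero    = proper
  pow∉ M M-prime@(_ , prime) x∉M (ℕ.suc n) = [ x∉M , pow∉ M M-prime x∉M n ]′ ∘ prime _ _

  pow-+ : ∀ x m n → pow R x (m ℕ.+ n) ≈ pow R x m * pow R x n
  pow-+ x ℕ.zero    n = sym (*-identityˡ _)
  pow-+ x (ℕ.suc m) n = trans (*-congˡ (pow-+ x m n)) (sym (*-assoc _ _ _))

  zeroIdeal : Ideal R
  zeroIdeal = record
    { mem  = λ x → Lift c (x ≈ 0#)
    ; resp = λ eq (lift p) → lift (trans (sym eq) p)
    ; 0∈   = lift refl
    ; +∈   = λ (lift p) (lift q) → lift (trans (+-cong p q) (+-identityˡ 0#))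
    ; *∈   = λ r (lift p) → lift (trans (*-congˡ p) (zeroʳ r))
    }

  -- The ideal I + (z). Membership carries the coefficient of `z`, so a proof that `1#` is a member
  -- provides an inverse of `z` modulo `I`.
  adjoin : Ideal R → Carrier → Ideal R
  adjoin I z = record
    { mem  = λ x → ∃ λ r → mem I (x - r * z)
    ; resp = λ eq (r , p) → r , resp I (+-congʳ eq) p
    ; 0∈   = 0# , resp I (solve 1 (λ z → :0 := :0 :- :0 :* z) refl z) (0∈ I)
    ; +∈   = λ {x} {y} (r , p) (s , q) → r + s ,
        resp I (solve 5 (λ x y r s z →
                  (x :- r :* z) :+ (y :- s :* z) := (x :+ y) :- (r :+ s) :* z)
                  refl x y r s z)
          (+∈ I p q)
    ; *∈   = λ t {x} (r , p) → t * r ,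
        resp I (solve 4 (λ t x r z → t :* (x :- r :* z) := t :* x :- (t :* r) :* z)
                  refl t x r z)
          (*∈ I t p)
    }

  ⊑-adjoin : ∀ (I : Ideal R) z → I ⊑ adjoin I z
  ⊑-adjoin I z x p = 0# , resp I (solve 2 (λ x z → x := x :- :0 :* z) refl x z) p

  ∈-adjoin : ∀ (I : Ideal R) z → mem (adjoin I z) z
  ∈-adjoin I z = 1# , resp I (solve 1 (λ z → :0 := z :- :1 :* z) refl z) (0∈ I)

  -- Lists of added generators form an index set small enough for excluded middle at level `c ⊔ ℓ`,
  -- unlike the type of all ideals.
  adjoinList : Ideal R → List Carrier → Ideal R
  adjoinList I []      = I
  adjoinList I (z ∷ l) = adjoin (adjoinList I l) z

  ⊑-adjoinList : ∀ (I : Ideal R) l → I ⊑ adjoinList I l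
  ⊑-adjoinList I []      x p = p
  ⊑-adjoinList I (z ∷ l) x p = ⊑-adjoin (adjoinList I l) z x (⊑-adjoinList I l x p)

  -- The ideal quotient (a) : (b). For nonzero `a` in a domain it consists of the x such that x b/a
  -- lies in `R`.
  colon : Carrier → Carrier → Ideal R
  colon a b = record
    { mem  = λ x → Divides R a (x * b)
    ; resp = λ eq (q , p) → q , trans p (*-congʳ eq)
    ; 0∈   = 0# , solve 2 (λ a b → :0 :* a := :0 :* b) refl a b
    ; +∈   = λ {x} {y} (q , p) (r , s) → q + r ,
        trans (distribʳ a q r) (trans (+-cong p s) (sym (distribʳ b x y)))
    ; *∈   = λ t (q , p) → t * q ,
        trans (*-assoc t q a) (trans (*-congˡ p) (sym (*-assoc t _ b)))
    }

  divides⇒⊑ : ∀ P I → IdealDivides R P I → I ⊑ P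
  divides⇒⊑ P I (J , product) x x∈I =
    let n , p , q , p∈ , _ , eq = proj₁ (product x) x∈I
    in resp P (sym eq) (sumF∈ P n λ i → resp P (*-comm (q i) (p i)) (*∈ P (q i) (p∈ i)))

  -- Comparing a maximal M with the ideal "x ∈ M or Q" decides Q.
  excludedMiddle : ∀ M → IsMaximalIdeal R M → ∀ (Q : Set (c ⊔ ℓ)) → Dec Q
  excludedMiddle M (proper , maximal) Q =
    [ (λ J⊑M → no (proper ∘ J⊑M 1# ∘ inj₂)) , [ ⊥-elim ∘ proper , yes ]′ ]′
      (maximal J (λ _ → inj₁))
    where
    J : Ideal R
    J = record
      { mem  = λ x → mem M x ⊎ Q
      ; resp = λ { eq (inj₁ p) → inj₁ (resp M eq p) ; _ (inj₂ q) → inj₂ q }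
      ; 0∈   = inj₁ (0∈ M)
      ; +∈   = λ { (inj₁ p) (inj₁ q) → inj₁ (+∈ M p q)
                 ; (inj₂ q) _        → inj₂ q
                 ; (inj₁ _) (inj₂ q) → inj₂ q }
      ; *∈   = λ { r (inj₁ p) → inj₁ (*∈ M r p) ; _ (inj₂ q) → inj₂ q }
      }

  -- Noetherian rings: maximal members of families and existence of primes

  module Noetherian
    (em : ∀ (Q : Set (c ⊔ ℓ)) → Dec Q)
    (noetherian : IsNoetherian R) where

    byContradiction : ∀ {Q : Set (c ⊔ ℓ)} → ¬ ¬ Q → Q
    byContradiction {Q} ¬¬q with em Q
    ... | yes q = q
    ... | no ¬q = contradiction ¬q ¬¬q

    ⋢⇒∃ : ∀ I J → ¬ I ⊑ J → ∃ λ x → mem I x × ¬ mem J x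
    ⋢⇒∃ I J I⋢J = byContradiction λ none →
      I⋢J λ x x∈I → byContradiction λ x∉J → none (x , x∈I , x∉J)

    -- Starting from `s₀`, pass to a strictly larger member whenever there is one. The resulting
    -- chain stops growing at some `N`, so no strictly larger member existed there.
    maximalElement : {S : Set (c ⊔ ℓ)} (J : S → Ideal R) → S →
      ∃ λ s → ∀ t → J s ⊑ J t → J t ⊑ J s
    maximalElement {S} J s₀ = chain N , maximal
      where
      Larger : S → Set (c ⊔ ℓ)
      Larger s = ∃ λ t → J s ⊑ J t × ∃ λ x → mem (J t) x × ¬ mem (J s) x

      next : ∀ s → Dec (Larger s) → S
      next s (yes (t , _)) = t
      next s (no _)        = s

      ⊑-next : ∀ s d → J s ⊑ J (next s d)
      ⊑-next s (yes (_ , s⊑t , _)) = s⊑t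
      ⊑-next s (no _)              = λ _ p → p

      next-⊑⇒maximal : ∀ s d → J (next s d) ⊑ J s → ∀ t → J s ⊑ J t → J t ⊑ J s
      next-⊑⇒maximal s (yes (_ , _ , x , x∈t , x∉s)) t⊑s = contradiction (t⊑s x x∈t) x∉s
      next-⊑⇒maximal s (no none) _ t s⊑t x x∈t =
        byContradiction λ x∉s → none (t , s⊑t , x , x∈t , x∉s)

      chain : ℕ → S
      chain ℕ.zero    = s₀
      chain (ℕ.suc n) = next (chain n) (em _)

      stable = noetherian (J ∘ chain) (λ n → ⊑-next (chain n) (em _))
      N = proj₁ stable

      maximal : ∀ t → J (chain N) ⊑ J t → J t ⊑ J (chain N)
      maximal = next-⊑⇒maximal (chain N) (em _) (proj₂ stable (ℕ.suc N) (ℕ.n≤1+n N))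

    -- A maximal proper ideal `P` among those obtained from `I` by adjoining finitely many elements
    -- is prime. Let xy be in `P`: if P + (x) contains 1, multiplying by y puts y in `P`; if not,
    -- maximality puts x in `P`.
    existsPrime : ∀ I → ProperIdeal R I → ∃ λ P → IsPrimeIdeal R P × I ⊑ P
    existsPrime I proper = P , (P-proper , prime) , ⊑-adjoinList I l
      where
      S : Set (c ⊔ ℓ)
      S = ∃ λ l → ProperIdeal R (adjoinList I l)

      max : ∃ λ (s : S) → ∀ (t : S) →
        adjoinList I (proj₁ s) ⊑ adjoinList I (proj₁ t) →
        adjoinList I (proj₁ t) ⊑ adjoinList I (proj₁ s)
      max = maximalElement (adjoinList I ∘ proj₁) ([] , proper)

      l = proj₁ (proj₁ max)
      P = adjoinList I l
      P-proper = proj₂ (proj₁ max)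

      prime : ∀ x y → mem P (x * y) → mem P x ⊎ mem P y
      prime x y xy∈P with em (mem (adjoin P x) 1#)
      ... | yes (r , 1-rx∈P) = inj₂ (resp P
              (solve 3 (λ x y r → y :* (:1 :- r :* x) :+ r :* (x :* y) := y) refl x y r)
              (+∈ P (*∈ P y 1-rx∈P) (*∈ P r xy∈P)))
      ... | no 1∉P+x = inj₁
              (proj₂ max (x ∷ l , 1∉P+x) (⊑-adjoin P x) x (∈-adjoin P x))

    -- Units and idempotents of the finite quotient ring

    UnitMod : Ideal R → Carrier → Set (c ⊔ ℓ)
    UnitMod I u = ∃ λ v → mem I (u * v - 1#)

    -- cᵖ ≡ cᵖ⁺ᵈ⁺¹ by the pigeonhole principle, and then c to the power p (d + 1) is idempotent.
    idempotentPower : ∀ I → QuotientFinite R I → ∀ c → ∃ λ g →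
      mem I (g * g - g) × (∃ λ s → s * c ≈ g) ×
      (∀ M → IsPrimeIdeal R M → ¬ mem M c → ¬ mem M g)
    idempotentPower I (n , f , cover) c
      with Fin.pigeonhole (ℕ.n<1+n n) (λ k → proj₁ (cover (pow R c (ℕ.suc (toℕ k)))))
    ... | i , j , i<j , same with ℕ.m≤n⇒∃[o]m+o≡n i<j
    ... | d , 1+i+d≡j =
      -- Since `p` is a successor, `p ℕ.* ℕ.suc d` computes to the successor of
      -- `d ℕ.+ toℕ i ℕ.* ℕ.suc d`, which splits off one factor `c`. This is why the pigeonhole
      -- exponents start at 1.
      pow R c (p ℕ.* ℕ.suc d) , idempotent , (pow R c (d ℕ.+ toℕ i ℕ.* ℕ.suc d) , *-comm _ c) ,
      λ M M-prime c∉M → pow∉ M M-prime c∉M (p ℕ.* ℕ.suc d)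
      where
      p = ℕ.suc (toℕ i)
      A = pow R c p

      period : mem I (A - A * pow R c (ℕ.suc d))
      period = ≋-trans I
        (≋-trans I (proj₂ (cover A))
          (≡.subst (λ k → mem I (f k - pow R c (ℕ.suc (toℕ j)))) (≡.sym same)
            (≋-sym I (proj₂ (cover (pow R c (ℕ.suc (toℕ j))))))))
        (≈⇒≋ I (trans
          (reflexive (≡.cong (pow R c)
            (≡.trans (≡.cong ℕ.suc (≡.sym 1+i+d≡j)) (≡.sym (ℕ.+-suc p d)))))
          (pow-+ c p (ℕ.suc d))))

      period* : ∀ k → mem I (A - A * pow R c (k ℕ.* ℕ.suc d))
      period* ℕ.zero    = ≈⇒≋ I (sym (*-identityʳ A))
      period* (ℕ.suc k) = resp I
        (begin
          (A - A * W) + W * (A - A * V)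
            ≈⟨ solve 3 (λ A W V → (A :- A :* W) :+ W :* (A :- A :* V) := A :- A :* (W :* V))
                 refl A W V ⟩
          A - A * (W * V)
            ≈⟨ +-congˡ (-‿cong (*-congˡ (sym (pow-+ c (ℕ.suc d) (k ℕ.* ℕ.suc d))))) ⟩
          A - A * pow R c (ℕ.suc k ℕ.* ℕ.suc d)   ∎)
        (+∈ I period (*∈ I W (period* k)))
        where
        W = pow R c (ℕ.suc d)
        V = pow R c (k ℕ.* ℕ.suc d)

      g = pow R c (p ℕ.* ℕ.suc d)
      B = pow R c (p ℕ.* d)

      AB≈g : A * B ≈ g
      AB≈g = trans (sym (pow-+ c p (p ℕ.* d)))
                   (reflexive (≡.cong (pow R c) (≡.sym (ℕ.*-suc p d))))

      idempotent : mem I (g * g - g)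
      -- As A B = g, multiplying the relation A ≡ A g by `B` gives g ≡ g g.
      idempotent = resp I
        (begin
          (- B) * (A - A * g)
            ≈⟨ solve 3 (λ A B g → (:- B) :* (A :- A :* g) := (A :* B) :* g :- A :* B)
                 refl A B g ⟩
          (A * B) * g - A * B   ≈⟨ +-cong (*-congʳ AB≈g) (-‿cong AB≈g) ⟩
          g * g - g             ∎)
        (*∈ I (- B) (period* p))

    -- For `e` idempotent modulo `I`, this is the element of R/I equal to `u` on the component of
    -- `e` and to `v` on the complementary one.
    glue : Carrier → Carrier → Carrier → Carrier
    glue e u v = e * u + (1# - e) * v

    glue-≋ : ∀ (I : Ideal R) e {u u′ v v′} → mem I (u - u′) → mem I (v - v′) →
      mem I (glue e u v - glue e u′ v′)
    glue-≋ I e {u} {u′} {v} {v′} p q = resp I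
      (solve 5 (λ e u u′ v v′ →
        e :* (u :- u′) :+ (:1 :- e) :* (v :- v′) :=
        (e :* u :+ (:1 :- e) :* v) :- (e :* u′ :+ (:1 :- e) :* v′)) refl e u u′ v v′)
      (+∈ I (*∈ I e p) (*∈ I (1# - e) q))

    glue-* : ∀ (I : Ideal R) {e} → mem I (e * e - e) → ∀ u v u′ v′ →
      mem I (glue e u v * glue e u′ v′ - glue e (u * u′) (v * v′))
    glue-* I {e} idem u v u′ v′ = resp I
      (solve 5 (λ e u v u′ v′ →
        ((u :- v) :* (u′ :- v′)) :* (e :* e :- e) :=
        (e :* u :+ (:1 :- e) :* v) :* (e :* u′ :+ (:1 :- e) :* v′) :-
        (e :* (u :* u′) :+ (:1 :- e) :* (v :* v′))) refl e u v u′ v′)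
      (*∈ I ((u - v) * (u′ - v′)) idem)

    -- Among the y and idempotents e of R/I such that y and x - y are units on the
    -- component e, one with maximal (e) has (e) = R/I: at a prime M containing e,
    -- changing y to z on the complementary component enlarges e.
    sumOfTwoUnits : ∀ I → QuotientFinite R I → ∀ x →
      (∀ M → IsPrimeIdeal R M → I ⊑ M → ∃ λ z → ¬ mem M z × ¬ mem M (x - z)) →
      ∃ λ u → UnitMod I u × UnitMod I (x - u)
    sumOfTwoUnits I finite x local =
      split (proj₁ maxP) (proj₂ maxP) (em _)
      where
      record Partial : Set (c ⊔ ℓ) where
        field
          y e t : Carrier
          idem  : mem I (e * e - e)
          -- Inverting the product inverts both factors, so a single `t` witnesses that `y` and
          -- `x - y` are units on the component `e`.
          unit  : mem I (e - t * (y * (x - y)))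
      open Partial

      trivial : Partial
      trivial = record
        { y = 0# ; e = 0# ; t = 0#
        ; idem = resp I (solve 0 (:0 := :0 :* :0 :- :0) refl) (0∈ I)
        ; unit = resp I (solve 1 (λ x → :0 := :0 :- :0 :* (:0 :* (x :- :0))) refl x) (0∈ I)
        }

      maxP : ∃ λ s → ∀ s′ → adjoin I (e s) ⊑ adjoin I (e s′) → adjoin I (e s′) ⊑ adjoin I (e s)
      maxP = maximalElement (adjoin I ∘ e) trivial

      module _ (s : Partial) where
        y₀ = y s
        e₀ = e s
        t₀ = t s

        module _ (z g r : Carrier)
                 (g-idem : mem I (g * g - g)) (rf≈g : r * (z * (x - z)) ≈ g) where

          enlarge : Partial
          enlarge = record
            { y = y′
            -- Modulo `I` this is e₀ + (1 - e₀) g, the join of two idempotents. In glued form, both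
            -- conditions can be checked on each component separately.
            ; e = glue e₀ e₀ g
            ; t = t′
            ; idem = ≋-trans I (glue-* I (idem s) e₀ g e₀ g) (glue-≋ I e₀ (idem s) g-idem)
            ; unit = ≋-trans I
                (glue-≋ I e₀ (unit s) (≋-sym I (≈⇒≋ I rf≈g)))
                (≋-sym I (≋-trans I
                  (≋-*ˡ I t′ product)
                  (glue-* I (idem s) t₀ r (y₀ * (x - y₀)) (z * (x - z)))))
            }
            where
            y′ = glue e₀ y₀ z
            t′ = glue e₀ t₀ r
            product : mem I (y′ * (x - y′) - glue e₀ (y₀ * (x - y₀)) (z * (x - z)))
            product = resp I
              (+-congʳ (*-congˡ (solve 4 (λ x y z e →
                e :* (x :- y) :+ (:1 :- e) :* (x :- z) := x :- (e :* y :+ (:1 :- e) :* z))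
                refl x y₀ z e₀)))
              (glue-* I (idem s) y₀ z (x - y₀) (x - z))

          ⊑-enlarge : adjoin I e₀ ⊑ adjoin I (e enlarge)
          -- Modulo `I`, `e₀` times the new idempotent is `e₀` again, whence the coefficient
          -- `k * e₀`.
          ⊑-enlarge w (k , p) = k * e₀ , resp I
            (solve 4 (λ w k e g →
              (w :- k :* e) :+ (k :* (g :- :1 :- e)) :* (e :* e :- e) :=
              w :- (k :* e) :* (e :* e :+ (:1 :- e) :* g))
              refl w k e₀ g)
            (+∈ I p (*∈ I (k * (g - 1# - e₀)) (idem s)))

          g∈adjoin : adjoin I (e enlarge) ⊑ adjoin I e₀ → mem (adjoin I e₀) g
          g∈adjoin e′⊑e = resp (adjoin I e₀)
            (solve 2 (λ e g → (e :* e :+ (:1 :- e) :* g) :+ (g :- e) :* e := g) refl e₀ g)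
            (+∈ (adjoin I e₀) (e′⊑e (e enlarge) (∈-adjoin I (e enlarge)))
                              (*∈ (adjoin I e₀) (g - e₀) (∈-adjoin I e₀)))

      split : ∀ s → (∀ s′ → adjoin I (e s) ⊑ adjoin I (e s′) → adjoin I (e s′) ⊑ adjoin I (e s)) →
        Dec (mem (adjoin I (e s)) 1#) → ∃ λ u → UnitMod I u × UnitMod I (x - u)
      split s maximal (yes (k , p)) = y s ,
        (k * t s * (x - y s) , resp I (+-congʳ
          (solve 4 (λ k t y y′ → k :* (t :* (y :* y′)) := y :* (k :* t :* y′))
            refl k (t s) (y s) (x - y s))) inverse) ,
        (k * t s * y s , resp I (+-congʳ
          (solve 4 (λ k t y y′ → k :* (t :* (y :* y′)) := y′ :* (k :* t :* y))
            refl k (t s) (y s) (x - y s))) inverse)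
        where
        inverse : mem I (k * (t s * (y s * (x - y s))) - 1#)
        inverse = ≋-sym I (≋-trans I p (≋-*ˡ I k (unit s)))
      split s maximal (no proper) =
        let M , M-prime , I+e⊑M = existsPrime (adjoin I (e s)) proper
            z , z∉M , x-z∉M = local M M-prime (λ w → I+e⊑M w ∘ ⊑-adjoin I (e s) w)
            g , g-idem , (r , rf≈g) , g∉ = idempotentPower I finite (z * (x - z))
            s′ = enlarge s z g r g-idem rf≈g
        -- Maximality would put `g` into I + (e), hence into `M`; but `z` and `x - z` lie outside
        -- the prime `M`, and so does `g`.
        in contradiction
          (I+e⊑M g (g∈adjoin s z g r g-idem rf≈g (maximal s′ (⊑-enlarge s z g r g-idem rf≈g))))
          (g∉ M M-prime ([ z∉M , x-z∉M ]′ ∘ proj₂ M-prime _ _))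

  -- Dedekind domains: a prime containing an ideal divides it

  module Dedekind
    (em : ∀ (Q : Set (c ⊔ ℓ)) → Dec Q)
    (dedekind : IsDedekindDomain R) where

    private
      noetherian = proj₁ (proj₂ dedekind)
      integrallyClosed = proj₁ (proj₂ (proj₂ dedekind))
      primesMaximal = proj₂ (proj₂ (proj₂ dedekind))
    open Noetherian em noetherian public

    nonzero-*-cancel : ∀ a x → ¬ (a ≈ 0#) → a * x ≈ 0# → x ≈ 0#
    nonzero-*-cancel a x a≉0 ax≈0 with proj₂ (proj₁ dedekind) a x ax≈0
    ... | inj₁ a≈0 = contradiction a≈0 a≉0
    ... | inj₂ x≈0 = x≈0

    *-cancelʳ-nonzero : ∀ {a} x y → ¬ (a ≈ 0#) → x * a ≈ y * a → x ≈ y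
    *-cancelʳ-nonzero {a} x y a≉0 eq = begin
      x            ≈⟨ solve 2 (λ x y → x := (x :- y) :+ y) refl x y ⟩
      (x - y) + y  ≈⟨ +-congʳ (nonzero-*-cancel a (x - y) a≉0 a[x-y]≈0) ⟩
      0# + y       ≈⟨ +-identityˡ y ⟩
      y            ∎
      where
      a[x-y]≈0 : a * (x - y) ≈ 0#
      a[x-y]≈0 = begin
        a * (x - y)    ≈⟨ solve 3 (λ a x y → a :* (x :- y) := x :* a :- y :* a) refl a x y ⟩
        x * a - y * a  ≈⟨ +-congʳ eq ⟩
        y * a - y * a  ≈⟨ -‿inverseʳ _ ⟩
        0#             ∎

    -- A maximal member of the family (a) : (b) ⊆ P is prime, hence maximal, hence P.
    associated : ∀ P a → IsPrimeIdeal R P → mem P a → ¬ (a ≈ 0#) →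
      ∃ λ b → ¬ Divides R a b × P ⊑ colon a b
    associated P a (P-proper , P-prime) a∈P a≉0 =
      b , (λ (q , eq) → 1∉Q (q , trans eq (sym (*-identityˡ b)))) , P⊑Q
      where
      S : Set (c ⊔ ℓ)
      S = ∃ λ b → colon a b ⊑ P

      max : ∃ λ (s : S) → ∀ (t : S) → colon a (proj₁ s) ⊑ colon a (proj₁ t) →
        colon a (proj₁ t) ⊑ colon a (proj₁ s)
      max = maximalElement (colon a ∘ proj₁) (1# , λ x (q , eq) →
        resp P (trans eq (*-identityʳ x)) (*∈ P q a∈P))

      b = proj₁ (proj₁ max)
      Q = colon a b
      Q⊑P : Q ⊑ P
      Q⊑P = proj₂ (proj₁ max)
      1∉Q : ¬ mem Q 1#
      1∉Q = P-proper ∘ Q⊑P 1#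

      Q⊑colon : ∀ y → Q ⊑ colon a (y * b)
      Q⊑colon y x (q , eq) = y * q , (begin
        (y * q) * a  ≈⟨ *-assoc y q a ⟩
        y * (q * a)  ≈⟨ *-congˡ eq ⟩
        y * (x * b)  ≈⟨ solve 3 (λ y x b → y :* (x :* b) := x :* (y :* b)) refl y x b ⟩
        x * (y * b)  ∎)

      Q-prime : ∀ x y → mem Q (x * y) → mem Q x ⊎ mem Q y
      -- If (a) : (yb) lies in `P`, it belongs to the family, and maximality of `Q` gives x in `Q`.
      -- Otherwise it contains some s outside `P`; then (a) : (sb) lies in `P` because `P` is prime,
      -- and maximality gives y in `Q`.
      Q-prime x y (q , qa≈xyb) with em (∃ λ s → mem (colon a (y * b)) s × ¬ mem P s)
      ... | no none = inj₁ (proj₂ max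
              (y * b , λ s s∈ → byContradiction λ s∉P → none (s , s∈ , s∉P))
              (Q⊑colon y) x (q , trans qa≈xyb (*-assoc x y b)))
      ... | yes (s , (r , ra≈syb) , s∉P) = inj₂ (proj₂ max
              (s * b , λ t (k , eq) → [ (λ t∈P → t∈P) , (λ s∈P → contradiction s∈P s∉P) ]′
                (P-prime t s (Q⊑P (t * s) (k , trans eq (sym (*-assoc t s b))))))
              (Q⊑colon s) y
              (r , trans ra≈syb
                (solve 3 (λ s y b → s :* (y :* b) := y :* (s :* b)) refl s y b)))

      P⊑Q : P ⊑ Q
      P⊑Q = [ (λ P⊑Q → P⊑Q) , (λ 1∈P → contradiction 1∈P P-proper) ]′
        (proj₂ (primesMaximal Q (1∉Q , Q-prime) (a , (b , *-comm b a) , a≉0)) P Q⊑P)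

    private
      span : (ℕ → Carrier) → ℕ → Ideal R
      span y ℕ.zero    = zeroIdeal
      span y (ℕ.suc n) = adjoin (span y n) (y n)

      -- `span` grows at its last index whereas `sumF` recurses on its first, so a summand is
      -- appended by induction with `y` shifted.
      sumF-snoc : ∀ n (y : ℕ → Carrier) (cs : Fin n → Carrier) r →
        ∃ λ (cs′ : Fin (ℕ.suc n) → Carrier) →
          sumF R n (λ i → cs i * y (toℕ i)) + r * y n ≈
          sumF R (ℕ.suc n) (λ i → cs′ i * y (toℕ i))
      sumF-snoc ℕ.zero y cs r = (λ _ → r) , +-comm 0# _
      sumF-snoc (ℕ.suc n) y cs r with sumF-snoc n (y ∘ ℕ.suc) (cs ∘ Fin.suc) r
      ... | cs′ , eq =
        (λ { Fin.zero → cs Fin.zero ; (Fin.suc i) → cs′ i }) ,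
        trans (+-assoc _ _ _) (+-congˡ eq)

      span⇒sumF : ∀ y n {x} → mem (span y n) x →
        ∃ λ (cs : Fin n → Carrier) → x ≈ sumF R n (λ i → cs i * y (toℕ i))
      span⇒sumF y ℕ.zero    (lift p) = (λ ()) , p
      span⇒sumF y (ℕ.suc n) {x} (r , p) with span⇒sumF y n p
      ... | cs , eq with sumF-snoc n y cs r
      ... | cs′ , eq′ = cs′ , (begin
        x                         ≈⟨ solve 2 (λ x s → x := (x :- s) :+ s) refl x (r * y n) ⟩
        (x - r * y n) + r * y n   ≈⟨ +-congʳ eq ⟩
        _                         ≈⟨ eq′ ⟩
        _                         ∎)

    -- Otherwise (b/a)ⁿ a stays in R for all n, and ACC on the ideals spanned by
    -- these elements gives an integral equation for b/a.
    noStableMultiplication : ∀ (P : Ideal R) {a b} → mem P a → ¬ (a ≈ 0#) → ¬ Divides R a b →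
      ¬ (∀ p → mem P p → ∃ λ y → mem P y × y * a ≈ p * b)
    noStableMultiplication P {a} {b} a∈P a≉0 a∤b mult =
      a∤b (integrallyClosed b a a≉0 N cs′ equation)
      where
      ys : ℕ → ∃ (mem P)
      ys ℕ.zero    = a , a∈P
      ys (ℕ.suc n) = let y , y∈P , _ = mult (proj₁ (ys n)) (proj₂ (ys n)) in y , y∈P

      y : ℕ → Carrier
      y = proj₁ ∘ ys

      y-pow : ∀ n → pow R a n * y n ≈ a * pow R b n
      y-pow ℕ.zero    = *-comm 1# a
      y-pow (ℕ.suc n) = begin
        (a * pow R a n) * y (ℕ.suc n)
          ≈⟨ solve 3 (λ a p y → (a :* p) :* y := p :* (y :* a)) refl a _ _ ⟩
        pow R a n * (y (ℕ.suc n) * a)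
          ≈⟨ *-congˡ (proj₂ (proj₂ (mult (proj₁ (ys n)) (proj₂ (ys n))))) ⟩
        pow R a n * (y n * b)           ≈⟨ *-assoc _ _ b ⟨
        (pow R a n * y n) * b           ≈⟨ *-congʳ (y-pow n) ⟩
        (a * pow R b n) * b
          ≈⟨ solve 3 (λ a p b → (a :* p) :* b := a :* (b :* p)) refl a _ b ⟩
        a * (b * pow R b n)             ∎

      stable = noetherian (span y) (λ n → ⊑-adjoin (span y n) (y n))
      N = proj₁ stable

      relation = span⇒sumF y N
        (proj₂ stable (ℕ.suc N) (ℕ.n≤1+n N) (y N) (∈-adjoin (span y N) (y N)))
      cs cs′ : Fin N → Carrier
      cs = proj₁ relation
      cs′ i = - cs i

      term : Fin N → Carrier
      term i = cs′ i * (pow R b (toℕ i) * pow R a (N ∸ toℕ i))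

      a*term : ∀ i → a * term i ≈ (- pow R a N) * (cs i * y (toℕ i))
      a*term i = begin
        a * (- cs i * (pow R b k * pow R a (N ∸ k)))
          ≈⟨ solve 4 (λ a c p q → a :* (:- c :* (p :* q)) := :- (c :* (q :* (a :* p))))
               refl a (cs i) _ _ ⟩
        - (cs i * (pow R a (N ∸ k) * (a * pow R b k)))
          ≈⟨ -‿cong (*-congˡ (*-congˡ (sym (y-pow k)))) ⟩
        - (cs i * (pow R a (N ∸ k) * (pow R a k * y k)))
          ≈⟨ solve 4 (λ c p q y → :- (c :* (p :* (q :* y))) := (:- (p :* q)) :* (c :* y))
               refl (cs i) _ _ (y k) ⟩
        - (pow R a (N ∸ k) * pow R a k) * (cs i * y k)
          ≈⟨ *-congʳ (-‿cong (sym (pow-+ a (N ∸ k) k))) ⟩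
        - pow R a (N ∸ k ℕ.+ k) * (cs i * y k)
          ≡⟨ ≡.cong (λ n → - pow R a n * (cs i * y k)) (ℕ.m∸n+n≡m (ℕ.<⇒≤ (Fin.toℕ<n i))) ⟩
        - pow R a N * (cs i * y k) ∎
        where k = toℕ i

      equation : pow R b N + sumF R N term ≈ 0#
      -- Multiplied by `a`, the left side becomes aᴺ times the difference of the two sides of
      -- `relation`, which expresses y N through the earlier y i.
      equation = nonzero-*-cancel a _ a≉0 (begin
        a * (pow R b N + sumF R N term)          ≈⟨ distribˡ a _ _ ⟩
        a * pow R b N + a * sumF R N term
          ≈⟨ +-cong (sym (y-pow N)) (*-distribˡ-sumF a N term) ⟩
        pow R a N * y N + sumF R N (λ i → a * term i)
          ≈⟨ +-congˡ (sumF-cong N a*term) ⟩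
        pow R a N * y N + sumF R N (λ i → (- pow R a N) * (cs i * y (toℕ i)))
          ≈⟨ +-congˡ (sym (*-distribˡ-sumF (- pow R a N) N _)) ⟩
        pow R a N * y N + (- pow R a N) * sumF R N (λ i → cs i * y (toℕ i))
          ≈⟨ +-congˡ (*-congˡ (sym (proj₂ relation))) ⟩
        pow R a N * y N + (- pow R a N) * y N
          ≈⟨ solve 2 (λ p y → p :* y :+ (:- p) :* y := :0) refl _ _ ⟩
        0#                                       ∎)

    -- The cofactor is K = (I : P). Some p in P has y = p b/a in R but outside P, and maximality
    -- provides r with 1 - ry in P. For z in I, the element w = z b/a lies in K and pw = yz, so z =
    -- (1 - ry) z + (rp) w lies in the product P K.
    ⊑⇒divides : ∀ P I → IsPrimeIdeal R P → NonzeroIdeal R I → I ⊑ P → IdealDivides R P I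
    ⊑⇒divides P I P-prime@(P-proper , _) (a , a∈I , a≉0) I⊑P = K , product
      where
      a∈P = I⊑P a a∈I

      assoc = associated P a P-prime a∈P a≉0
      b = proj₁ assoc
      a∤b = proj₁ (proj₂ assoc)
      P⊑a:b = proj₂ (proj₂ assoc)

      K : Ideal R
      K = record
        { mem  = λ k → ∀ p → mem P p → mem I (p * k)
        ; resp = λ eq h p p∈ → resp I (*-congˡ eq) (h p p∈)
        ; 0∈   = λ p _ → resp I (sym (zeroʳ p)) (0∈ I)
        ; +∈   = λ h k p p∈ → resp I (sym (distribˡ p _ _)) (+∈ I (h p p∈) (k p p∈))
        ; *∈   = λ r {x} h p p∈ → resp I
            (solve 3 (λ r p x → r :* (p :* x) := p :* (r :* x)) refl r p x)
            (*∈ I r (h p p∈))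
        }

      I⊑K : I ⊑ K
      I⊑K x x∈I p _ = *∈ I p x∈I

      escaping : ∃ λ p → mem P p × ∃ λ y → y * a ≈ p * b × ¬ mem P y
      escaping = byContradiction λ none →
        noStableMultiplication P a∈P a≉0 a∤b λ p p∈P →
          let y , eq = P⊑a:b p p∈P
          in y , byContradiction (λ y∉P → none (p , p∈P , y , eq , y∉P)) , eq

      p = proj₁ escaping
      p∈P = proj₁ (proj₂ escaping)
      y = proj₁ (proj₂ (proj₂ escaping))
      ya≈pb = proj₁ (proj₂ (proj₂ (proj₂ escaping)))
      y∉P = proj₂ (proj₂ (proj₂ (proj₂ escaping)))

      unit-mod-P : ∃ λ r → mem P (1# - r * y)
      unit-mod-P = [ (λ P+y⊑P → contradiction (P+y⊑P y (∈-adjoin P y)) y∉P) , (λ u → u) ]′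
        (proj₂ (primesMaximal P P-prime (a , a∈P , a≉0)) (adjoin P y) (⊑-adjoin P y))

      r = proj₁ unit-mod-P

      module _ (z : Carrier) (z∈I : mem I z) where
        w = proj₁ (P⊑a:b z (I⊑P z z∈I))
        wa≈zb : w * a ≈ z * b
        wa≈zb = proj₂ (P⊑a:b z (I⊑P z z∈I))

        w∈K : mem K w
        w∈K q q∈P = let q′ , q′a≈qb = P⊑a:b q q∈P in
          resp I (*-cancelʳ-nonzero _ _ a≉0 (begin
            (q′ * z) * a  ≈⟨ solve 3 (λ q z a → (q :* z) :* a := z :* (q :* a)) refl q′ z a ⟩
            z * (q′ * a)  ≈⟨ *-congˡ q′a≈qb ⟩
            z * (q * b)   ≈⟨ solve 3 (λ z q b → z :* (q :* b) := q :* (z :* b)) refl z q b ⟩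
            q * (z * b)   ≈⟨ *-congˡ wa≈zb ⟨
            q * (w * a)   ≈⟨ *-assoc q w a ⟨
            (q * w) * a   ∎))
          (*∈ I q′ z∈I)

        pw≈yz : p * w ≈ y * z
        pw≈yz = *-cancelʳ-nonzero _ _ a≉0 (begin
          (p * w) * a  ≈⟨ *-assoc p w a ⟩
          p * (w * a)  ≈⟨ *-congˡ wa≈zb ⟩
          p * (z * b)  ≈⟨ solve 3 (λ p z b → p :* (z :* b) := z :* (p :* b)) refl p z b ⟩
          z * (p * b)  ≈⟨ *-congˡ ya≈pb ⟨
          z * (y * a)  ≈⟨ solve 3 (λ z y a → z :* (y :* a) := (y :* z) :* a) refl z y a ⟩
          (y * z) * a  ∎)

        decomposition : InProduct R P K z
        decomposition = 2 , ps , qs , ps∈P , qs∈K , (begin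
          z
            ≈⟨ solve 3 (λ r y z → z := (:1 :- r :* y) :* z :+ (r :* (y :* z) :+ :0)) refl r y z ⟩
          (1# - r * y) * z + (r * (y * z) + 0#)
            ≈⟨ +-congˡ (+-congʳ (*-congˡ pw≈yz)) ⟨
          (1# - r * y) * z + (r * (p * w) + 0#)
            ≈⟨ +-congˡ (+-congʳ (sym (*-assoc r p w))) ⟩
          (1# - r * y) * z + ((r * p) * w + 0#)  ∎)
          where
          ps qs : Fin 2 → Carrier
          ps Fin.zero    = 1# - r * y
          ps (Fin.suc _) = r * p
          qs Fin.zero    = z
          qs (Fin.suc _) = w
          ps∈P : ∀ i → mem P (ps i)
          ps∈P Fin.zero    = proj₂ unit-mod-P
          ps∈P (Fin.suc _) = *∈ P r p∈P
          qs∈K : ∀ i → mem K (qs i)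
          qs∈K Fin.zero    = I⊑K z z∈I
          qs∈K (Fin.suc _) = w∈K

      product : ∀ x → (mem I x → InProduct R P K x) × (InProduct R P K x → mem I x)
      product x = decomposition x , λ (n , ps , qs , ps∈P , qs∈K , eq) →
        resp I (sym eq) (sumF∈ I n (λ i → qs∈K i (ps i) (ps∈P i)))

  -- Two-element residue fields and products outside a prime

  cardTwo-sub∈ : ∀ P → QuotientCard R P 2 → ∀ {x y} → ¬ mem P x → ¬ mem P y → mem P (x - y)
  cardTwo-sub∈ P (f , cover , _) {x} {y} x∉P y∉P = ≋-trans P (proj₂ (cover x))
    (≡.subst (λ i → mem P (f i - y))
      -- Neither class is that of `0#`, and only one other class exists.
      (sameClass _ _ _ (class≢ y y∉P) (class≢ x x∉P))
      (≋-sym P (proj₂ (cover y))))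
    where
    class : Carrier → Fin 2
    class z = proj₁ (cover z)

    class≢ : ∀ z → ¬ mem P z → class z ≢ class 0#
    class≢ z z∉P eq = z∉P (∈-of-sub∈ P
      (≋-trans P (proj₂ (cover z))
        (≡.subst (λ i → mem P (f i - 0#)) (≡.sym eq) (≋-sym P (proj₂ (cover 0#)))))
      (0∈ P))

    sameClass : ∀ (i j k : Fin 2) → i ≢ k → j ≢ k → i ≡ j
    sameClass Fin.zero Fin.zero _ _ _ = ≡.refl
    sameClass (Fin.suc Fin.zero) (Fin.suc Fin.zero) _ _ _ = ≡.refl
    sameClass Fin.zero (Fin.suc Fin.zero) Fin.zero i≢k _ = contradiction ≡.refl i≢k
    sameClass Fin.zero (Fin.suc Fin.zero) (Fin.suc Fin.zero) _ j≢k = contradiction ≡.refl j≢k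
    sameClass (Fin.suc Fin.zero) Fin.zero Fin.zero _ j≢k = contradiction ≡.refl j≢k
    sameClass (Fin.suc Fin.zero) Fin.zero (Fin.suc Fin.zero) i≢k _ = contradiction ≡.refl i≢k

  -- The product of the local witnesses works: primality keeps it outside `Q`. The condition `A`
  -- serves to exempt one index, where nothing but avoiding `Q` is asked.
  avoiding : ∀ Q → IsPrimeIdeal R Q → ∀ n (J : Fin n → Ideal R) (A : Fin n → Set) →
    (∀ j → ∃ λ e → ¬ mem Q e × (A j → mem (J j) e)) →
    ∃ λ e → ¬ mem Q e × (∀ j → A j → mem (J j) e)
  avoiding Q (proper , _) ℕ.zero J A h = 1# , proper , λ ()
  avoiding Q Q-prime (ℕ.suc n) J A h =
    let e , e∉Q , e∈  = h Fin.zero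
        d , d∉Q , d∈J = avoiding Q Q-prime n (J ∘ Fin.suc) (A ∘ Fin.suc) (h ∘ Fin.suc)
    in e * d , [ e∉Q , d∉Q ]′ ∘ proj₂ Q-prime e d , λ
      { Fin.zero    a → resp (J Fin.zero) (*-comm d e) (*∈ (J Fin.zero) d (e∈ a))
      ; (Fin.suc j) a → *∈ (J (Fin.suc j)) e (d∈J j a) }

  -- Parity of differences and walks in the graph

  module Components
    (em : ∀ (Q : Set (c ⊔ ℓ)) → Dec Q)
    (dedekind : IsDedekindDomain R)
    (I : Ideal R) (I-nonzero : NonzeroIdeal R I) (finite : QuotientFinite R I)
    (m : ℕ) (primes : ExactlyTwoPrimeDivisors R I (ℕ.suc m)) where

    open Dedekind em dedekind

    private
      P : Fin (ℕ.suc m) → Ideal R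
      P = proj₁ primes

      P-prime : ∀ i → IsPrimeIdeal R (P i)
      P-prime i = proj₁ (proj₁ (proj₂ primes) i)

      I⊑P : ∀ i → I ⊑ P i
      I⊑P i = divides⇒⊑ (P i) I (proj₁ (proj₂ (proj₁ (proj₂ primes) i)))

      P-cardTwo : ∀ i → QuotientCard R (P i) 2
      P-cardTwo i = proj₂ (proj₂ (proj₁ (proj₂ primes) i))

    Even Odd Parity : Carrier → Set (c ⊔ ℓ)
    Even x = ∀ i → mem (P i) x
    Odd x = ∀ i → ¬ mem (P i) x
    Parity x = Even x ⊎ Odd x

    1-odd : Odd 1#
    1-odd i = proj₁ (P-prime i)

    parity-resp : ∀ {x y} → x ≈ y → Parity x → Parity y
    parity-resp eq (inj₁ even) = inj₁ λ i → resp (P i) eq (even i)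
    parity-resp eq (inj₂ odd)  = inj₂ λ i → odd i ∘ resp (P i) (sym eq)

    -- Only the case of two odd elements uses that the residue fields have two elements.
    parity-sub : ∀ {x y} → Parity x → Parity y → Parity (x - y)
    parity-sub (inj₁ p) (inj₁ q) = inj₁ λ i → sub∈ (P i) (p i) (q i)
    parity-sub (inj₁ p) (inj₂ q) = inj₂ λ i x-y∈P →
      q i (∈-of-sub∈ (P i) (≋-sym (P i) x-y∈P) (p i))
    parity-sub (inj₂ p) (inj₁ q) = inj₂ λ i x-y∈P → p i (∈-of-sub∈ (P i) x-y∈P (q i))
    parity-sub (inj₂ p) (inj₂ q) = inj₁ λ i → cardTwo-sub∈ (P i) (P-cardTwo i) (p i) (q i)

    adj⇒odd : ∀ {a b} → Adj R I a b → Odd (a - b)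
    adj⇒odd {a} {b} (u , p) i a-b∈P = 1-odd i (∈-of-sub∈ (P i)
      (≋-sym (P i) (I⊑P i _ p))
      (resp (P i) (*-comm u (a - b)) (*∈ (P i) u a-b∈P)))

    reach⇒parity : ∀ {a b} → Reach R I a b → Parity (a - b)
    reach⇒parity (here p) = inj₁ λ i → I⊑P i _ p
    reach⇒parity (step {a} {b} {d} adj walk) = parity-resp
      -- The sum of differences is rewritten with subtractions only, so that `parity-sub` covers it.
      (solve 3 (λ a b d → (a :- b) :- (:0 :- (b :- d)) := a :- d) refl a b d)
      (parity-sub (inj₂ (adj⇒odd adj))
        (parity-sub (inj₁ λ i → 0∈ (P i)) (reach⇒parity walk)))

    unitMod-resp : ∀ {u v} → u ≈ v → UnitMod I u → UnitMod I v
    unitMod-resp eq (w , p) = w , resp I (+-congʳ (*-congʳ eq)) p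

    -- If every z ≢ 0 mod M has x ≡ z, then R/M = {0, 1} and x ≢ 0 mod M.
    even⇒sumOfTwoUnits : ∀ {x} → Even x → ∃ λ u → UnitMod I u × UnitMod I (x - u)
    even⇒sumOfTwoUnits {x} even = sumOfTwoUnits I finite x λ M M-prime I⊑M →
      byContradiction λ none →
        let M-proper = proj₁ M-prime
            dichotomy : ∀ z → ¬ mem M z → mem M (x - z)
            dichotomy z z∉M = byContradiction λ x-z∉M → none (z , z∉M , x-z∉M)
            i , M⊑P , P⊑M = proj₂ (proj₂ (proj₂ primes)) M M-prime
              (⊑⇒divides M I M-prime I-nonzero I⊑M) (twoElements M M-proper dichotomy)
        -- `M` equals some `P i`, so it contains the even `x`; but x ≡ 1 modulo `M`.
        in M-proper (∈-of-sub∈ M (≋-sym M (dichotomy 1# M-proper)) (P⊑M x (even i)))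
      where
      f : Fin 2 → Carrier
      f Fin.zero    = 0#
      f (Fin.suc _) = 1#

      twoElements : ∀ M → ProperIdeal R M → (∀ z → ¬ mem M z → mem M (x - z)) →
        QuotientCard R M 2
      twoElements M proper dichotomy = f , cover , distinct
        where
        cover : ∀ z → ∃ λ i → mem M (z - f i)
        cover z with em (mem M z)
        ... | yes z∈M = Fin.zero , sub∈ M z∈M (0∈ M)
        ... | no z∉M  = Fin.suc Fin.zero ,
                ≋-trans M (≋-sym M (dichotomy z z∉M)) (dichotomy 1# proper)

        distinct : ∀ i j → mem M (f i - f j) → i ≡ j
        distinct Fin.zero Fin.zero _ = ≡.refl
        distinct (Fin.suc Fin.zero) (Fin.suc Fin.zero) _ = ≡.refl
        distinct Fin.zero (Fin.suc Fin.zero) p =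
          contradiction (∈-of-sub∈ M (≋-sym M p) (0∈ M)) proper
        distinct (Fin.suc Fin.zero) Fin.zero p =
          contradiction (∈-of-sub∈ M p (0∈ M)) proper

    walk-refl : ∀ n {a} → WalkWithin R I n a a
    walk-refl ℕ.zero    = ≋-refl I
    walk-refl (ℕ.suc n) = inj₁ (≋-refl I)

    even⇒walk : ∀ n {a b} → Even (a - b) → WalkWithin R I (2 ℕ.+ n) a b
    even⇒walk n {a} {b} even =
      let u , u-unit , v-unit = even⇒sumOfTwoUnits even
      -- With `a - u` as midpoint, the two edges have differences `u` and (a - b) - u, the two units
      -- found.
      in inj₂ (a - u ,
           unitMod-resp (solve 2 (λ a u → u := a :- (a :- u)) refl a u) u-unit ,
           inj₂ (b ,
             unitMod-resp (solve 3 (λ a b u → (a :- b) :- u := (a :- u) :- b) refl a b u) v-unit ,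
             walk-refl n))

    parity⇒walk : ∀ {a b} → Parity (a - b) → WalkWithin R I 3 a b
    parity⇒walk (inj₁ even) = even⇒walk 1 even
    -- As 1 is an odd unit, the step to `a - 1#` makes the remaining difference even.
    parity⇒walk {a} {b} (inj₂ odd) = inj₂ (a - 1# ,
      (1# , ≈⇒≋ I (solve 1 (λ a → (a :- (a :- :1)) :* :1 := :1) refl a)) ,
      even⇒walk 0 λ i → resp (P i)
        (solve 2 (λ a b → (a :- b) :- :1 := (a :- :1) :- b) refl a b)
        (cardTwo-sub∈ (P i) (P-cardTwo i) (odd i) (1-odd i)))

    walk⇒reach : ∀ n {a b} → WalkWithin R I n a b → Reach R I a b
    walk⇒reach ℕ.zero    p                        = here p
    walk⇒reach (ℕ.suc n) (inj₁ p)                 = here p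
    walk⇒reach (ℕ.suc n) (inj₂ (d , adj , walk)) = step adj (walk⇒reach n walk)

    parity⇒reach : ∀ {a b} → Parity (a - b) → Reach R I a b
    parity⇒reach = walk⇒reach 3 ∘ parity⇒walk

    -- Chinese remaindering and the count of components

    separator : ∀ i j → j ≢ i → ∃ λ e → mem (P j) e × ¬ mem (P i) e
    separator i j j≢i = ⋢⇒∃ (P j) (P i) λ Pj⊑Pi →
      -- `P j` is a nonzero prime, hence maximal: the inclusion is an equality unless `P i` is
      -- improper.
      [ (λ Pi⊑Pj → j≢i (proj₁ (proj₂ (proj₂ primes)) j i (Pj⊑Pi , Pi⊑Pj))) , 1-odd i ]′
        (proj₂ (proj₂ (proj₂ (proj₂ dedekind)) (P j) (P-prime j)
          (let a , a∈I , a≉0 = I-nonzero in a , I⊑P j a a∈I , a≉0))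
          (P i) Pj⊑Pi)

    indicator : ∀ i → ∃ λ e → ¬ mem (P i) e × (∀ j → j ≢ i → mem (P j) e)
    indicator i = avoiding (P i) (P-prime i) (ℕ.suc m) P (_≢ i) λ j → separate j (j Fin.≟ i)
      where
      separate : ∀ j → Dec (j ≡ i) → ∃ λ e → ¬ mem (P i) e × (j ≢ i → mem (P j) e)
      -- The neutral factor 1 stands at the exempt index.
      separate j (yes j≡i) = 1# , 1-odd i , contradiction j≡i
      separate j (no j≢i)  = let e , e∈ , e∉ = separator i j j≢i in e , e∉ , λ _ → e∈

    scale : Fin 2 → Carrier → Carrier
    scale Fin.zero    x = 0#
    scale (Fin.suc _) x = x

    scale∈ : ∀ (J : Ideal R) d {x} → mem J x → mem J (scale d x)
    scale∈ J Fin.zero    _ = 0∈ J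
    scale∈ J (Fin.suc _) p = p

    -- Summing the indicators at the nonzero digits suffices, because modulo `P i` only the term at
    -- `i` survives.
    chinese : ∀ (v : Fin (ℕ.suc m) → Fin 2) →
      ∃ λ r → ∀ i → (v i ≡ Fin.zero → mem (P i) r) × (v i ≢ Fin.zero → ¬ mem (P i) r)
    chinese v = r , residue
      where
      term : Fin (ℕ.suc m) → Carrier
      term i = scale (v i) (proj₁ (indicator i))

      r = sumF R (ℕ.suc m) term

      r≋term : ∀ i → mem (P i) (r - term i)
      r≋term i = sumF-single (P i) (ℕ.suc m) term i λ j j≢i →
        scale∈ (P i) (v j) (proj₂ (proj₂ (indicator j)) i (j≢i ∘ ≡.sym))

      residue : ∀ i → (v i ≡ Fin.zero → mem (P i) r) × (v i ≢ Fin.zero → ¬ mem (P i) r)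
      residue i with v i | proj₂ (indicator i) | r≋term i
      ... | Fin.zero  | _        | p = (λ _ → ∈-of-sub∈ (P i) p (0∈ (P i))) ,
                                       (λ 0≢0 → contradiction ≡.refl 0≢0)
      ... | Fin.suc _ | e∉ , _   | p = (λ ()) ,
                                       (λ _ r∈P → e∉ (∈-of-sub∈ (P i) (≋-sym (P i) p) r∈P))

    -- Complementary patterns of residues lie in one component. Fixing the first digit to zero
    -- selects one pattern from each pair, which accounts for the exponent `m` with `ℕ.suc m`
    -- primes.
    digits : Fin (2 ^ m) → Fin (ℕ.suc m) → Fin 2
    digits j Fin.zero    = Fin.zero
    digits j (Fin.suc k) = finToFun j k

    reps : Fin (2 ^ m) → Carrier
    reps j = proj₁ (chinese (digits j))

    funToFin-cong : ∀ {n k} {f g : Fin n → Fin k} → f ≗ g → funToFin f ≡ funToFin g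
    funToFin-cong {ℕ.zero}  eq = ≡.refl
    funToFin-cong {ℕ.suc n} eq = ≡.cong₂ combine (eq Fin.zero) (funToFin-cong (eq ∘ Fin.suc))

    reps-distinct : ∀ i j → Reach R I (reps i) (reps j) → i ≡ j
    reps-distinct i j walk with reach⇒parity walk
    -- The fixed first digit puts both representatives into `P Fin.zero`, so their difference is not
    -- odd.
    ... | inj₂ odd = contradiction
            (sub∈ (P Fin.zero) (proj₁ (proj₂ (chinese (digits i)) Fin.zero) ≡.refl)
                               (proj₁ (proj₂ (chinese (digits j)) Fin.zero) ≡.refl))
            (odd Fin.zero)
    ... | inj₁ even = ≡.trans (≡.sym (Fin.funToFin-finToFin {m} i))
            (≡.trans (funToFin-cong sameDigit) (Fin.funToFin-finToFin {m} j))
      where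
      compare : ∀ (Q : Ideal R) {x y} (a b : Fin 2) →
        (a ≡ Fin.zero → mem Q x) × (a ≢ Fin.zero → ¬ mem Q x) →
        (b ≡ Fin.zero → mem Q y) × (b ≢ Fin.zero → ¬ mem Q y) → mem Q (x - y) → a ≡ b
      compare Q Fin.zero Fin.zero _ _ _ = ≡.refl
      compare Q (Fin.suc Fin.zero) (Fin.suc Fin.zero) _ _ _ = ≡.refl
      compare Q Fin.zero (Fin.suc Fin.zero) (x∈ , _) (_ , y∉) p =
        contradiction (∈-of-sub∈ Q (≋-sym Q p) (x∈ ≡.refl)) (y∉ λ ())
      compare Q (Fin.suc Fin.zero) Fin.zero (_ , x∉) (y∈ , _) p =
        contradiction (∈-of-sub∈ Q p (y∈ ≡.refl)) (x∉ λ ())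

      sameDigit : finToFun i ≗ finToFun j
      sameDigit k = compare (P (Fin.suc k)) _ _
        (proj₂ (chinese (digits i)) (Fin.suc k)) (proj₂ (chinese (digits j)) (Fin.suc k))
        (even (Fin.suc k))

    -- Taking x ∈ P or x ∉ P for `A` yields the representative that imitates x or the one that
    -- complements it.
    reps-surjective : ∀ {A : Fin m → Set (c ⊔ ℓ)} → (∀ k → Dec (A k)) →
      ∃ λ j → mem (P Fin.zero) (reps j) ×
        (∀ k → A k → mem (P (Fin.suc k)) (reps j)) ×
        (∀ k → ¬ A k → ¬ mem (P (Fin.suc k)) (reps j))
    reps-surjective {A} A? = j , proj₁ (residue Fin.zero) ≡.refl ,
      (λ k a → proj₁ (residue (Fin.suc k)) (≡.trans (digits-j k) (digit-yes (A? k) a))) ,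
      (λ k ¬a → proj₂ (residue (Fin.suc k)) (digit-no (A? k) ¬a ∘ ≡.trans (≡.sym (digits-j k))))
      where
      digit : ∀ {Q : Set (c ⊔ ℓ)} → Dec Q → Fin 2
      digit (yes _) = Fin.zero
      digit (no _)  = Fin.suc Fin.zero

      digit-yes : ∀ {Q} (d : Dec Q) → Q → digit d ≡ Fin.zero
      digit-yes (yes _) _ = ≡.refl
      digit-yes (no ¬q) q = contradiction q ¬q

      digit-no : ∀ {Q} (d : Dec Q) → ¬ Q → digit d ≢ Fin.zero
      digit-no (yes q) ¬q = contradiction q ¬q
      digit-no (no _)  _  = λ ()

      v : Fin m → Fin 2
      v k = digit (A? k)

      j = funToFin v
      residue = proj₂ (chinese (digits j))

      digits-j : ∀ k → digits j (Fin.suc k) ≡ v k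
      digits-j = Fin.finToFun-funToFin v

    -- For `x` in the first prime, the representative with the same pattern has even difference to
    -- `x`; otherwise the one with the complementary pattern has odd difference.
    reps-cover : ∀ x → ∃ λ i → Reach R I (reps i) x
    reps-cover x = cover (em (mem (P Fin.zero) x))
      where
      cover : Dec (mem (P Fin.zero) x) → ∃ λ i → Reach R I (reps i) x
      cover (yes x∈P₀) = j , parity⇒reach (inj₁ even)
        where
        x∈? = λ k → em (mem (P (Fin.suc k)) x)
        sur = reps-surjective x∈?
        j = proj₁ sur

        caseOf : ∀ k → Dec (mem (P (Fin.suc k)) x) → mem (P (Fin.suc k)) (reps j - x)
        caseOf k (yes x∈P) = sub∈ (P (Fin.suc k)) (proj₁ (proj₂ (proj₂ sur)) k x∈P) x∈P
        caseOf k (no x∉P)  = cardTwo-sub∈ (P (Fin.suc k)) (P-cardTwo (Fin.suc k))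
          (proj₂ (proj₂ (proj₂ sur)) k x∉P) x∉P

        even : Even (reps j - x)
        even Fin.zero    = sub∈ (P Fin.zero) (proj₁ (proj₂ sur)) x∈P₀
        even (Fin.suc k) = caseOf k (x∈? k)
      cover (no x∉P₀) = j , parity⇒reach (inj₂ odd)
        where
        x∉? = λ k → em (¬ mem (P (Fin.suc k)) x)
        sur = reps-surjective x∉?
        j = proj₁ sur

        odd : Odd (reps j - x)
        odd Fin.zero p =
          x∉P₀ (∈-of-sub∈ (P Fin.zero) (≋-sym (P Fin.zero) p) (proj₁ (proj₂ sur)))
        -- By `p`, `reps j` and `x` lie in this prime together or not at all, yet the pattern was
        -- chosen complementary.
        odd (Fin.suc k) p = x∈⇒⊥ (byContradiction x∉⇒⊥)
          where
          Pₖ = P (Fin.suc k)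
          x∉⇒⊥ : ¬ ¬ mem Pₖ x
          x∉⇒⊥ x∉P =
            x∉P (∈-of-sub∈ Pₖ (≋-sym Pₖ p) (proj₁ (proj₂ (proj₂ sur)) k x∉P))
          x∈⇒⊥ : ¬ mem Pₖ x
          x∈⇒⊥ x∈P = proj₂ (proj₂ (proj₂ sur)) k (λ x∉P → x∉P x∈P) (∈-of-sub∈ Pₖ p x∈P)

    -- Bipartiteness and isomorphism of the components

    component-parity : ∀ {r a b} → Reach R I r a → Reach R I r b → Parity (a - b)
    component-parity {r} {a} {b} r~a r~b = parity-resp
      (solve 3 (λ r a b → (r :- b) :- (r :- a) := a :- b) refl r a b)
      (parity-sub (reach⇒parity r~b) (reach⇒parity r~a))

    -- Membership in one prime already colors the whole graph: adjacent vertices cannot both lie in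
    -- it, nor both outside, as its residue field has two elements.
    bipartite : ∀ r → BipartiteComp R I r
    bipartite r = color , (λ a b _ _ → sameColor a b) , (λ a b _ _ → differentColor a b)
      where
      P₀ = P Fin.zero

      color : Carrier → Bool
      color a = does (em (mem P₀ a))

      sameColor : ∀ a b → mem I (a - b) → color a ≡ color b
      sameColor a b p with em (mem P₀ a) | em (mem P₀ b)
      ... | yes _   | yes _   = ≡.refl
      ... | no _    | no _    = ≡.refl
      ... | yes a∈P | no b∉P  =
        contradiction (∈-of-sub∈ P₀ (≋-sym P₀ (I⊑P Fin.zero _ p)) a∈P) b∉P
      ... | no a∉P  | yes b∈P = contradiction (∈-of-sub∈ P₀ (I⊑P Fin.zero _ p) b∈P) a∉P

      differentColor : ∀ a b → Adj R I a b → color a ≢ color b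
      differentColor a b adj with em (mem P₀ a) | em (mem P₀ b)
      ... | yes a∈P | yes b∈P = λ _ → adj⇒odd adj Fin.zero (sub∈ P₀ a∈P b∈P)
      ... | no a∉P  | no b∉P  = λ _ →
        adj⇒odd adj Fin.zero (cardTwo-sub∈ P₀ (P-cardTwo Fin.zero) a∉P b∉P)
      ... | yes _   | no _    = λ ()
      ... | no _    | yes _   = λ ()

    -- Translation by s - r leaves all differences unchanged, and with them congruence, adjacency
    -- and the parity relative to the base point.
    translation : ∀ r s → CompIso R I r s
    translation r s =
      (λ a → a + (s - r)) , (λ b → b + (r - s)) ,
      (λ a → reach-translate r s) ,
      (λ b → reach-translate s r) ,
      (λ a a′ _ _ → resp I (difference a a′ (s - r))) ,
      (λ b b′ _ _ → resp I (difference b b′ (r - s))) ,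
      (λ a _ → ≈⇒≋ I (inverse a r s)) ,
      (λ b _ → ≈⇒≋ I (inverse b s r)) ,
      (λ a a′ _ _ → unitMod-resp (difference a a′ (s - r)) ,
                    unitMod-resp (sym (difference a a′ (s - r))))
      where
      difference : ∀ a b t → a - b ≈ (a + t) - (b + t)
      difference = solve 3 (λ a b t → a :- b := (a :+ t) :- (b :+ t)) refl

      inverse : ∀ a r s → (a + (s - r)) + (r - s) ≈ a
      inverse = solve 3 (λ a r s → (a :+ (s :- r)) :+ (r :- s) := a) refl

      reach-translate : ∀ r s {a} → Reach R I r a → Reach R I s (a + (s - r))
      reach-translate r s {a} r~a = parity⇒reach (parity-resp
        (solve 3 (λ r s a → r :- a := s :- (a :+ (s :- r))) refl r s a)
        (reach⇒parity r~a))

theorem6p2 : ∀ {c ℓ : Level} (R : CommutativeRing c ℓ) → IsDedekindDomain R →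
    (I : Ideal R) → NonzeroIdeal R I → QuotientFinite R I → QuotientNontrivial R I →
    (m : ℕ) → 1 ≤ m → ExactlyTwoPrimeDivisors R I m →
    Σ (Fin (2 ^ (m ∸ 1)) → CommutativeRing.Carrier R) λ reps →
    (∀ i j → Reach R I (reps i) (reps j) → i ≡ j) ×
    (∀ x → ∃ λ i → Reach R I (reps i) x) ×
    (∀ i → BipartiteComp R I (reps i)) ×
    (∀ i j → CompIso R I (reps i) (reps j)) ×
    (∀ i → DiameterAtMost R I (reps i) 3)
theorem6p2 R dedekind I I-nonzero@(a , a∈I , a≉0) finite _ (ℕ.suc m) _ primes@(Ps , props , _) =
  reps , reps-distinct , reps-cover , (λ i → bipartite (reps i)) ,
  (λ i j → translation (reps i) (reps j)) ,
  (λ i a b r~a r~b → parity⇒walk (component-parity r~a r~b))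
  where
  open IdealTheory R

  P₀ = Ps Fin.zero
  P₀-prime = proj₁ (props Fin.zero)

  em : ∀ Q → Dec Q
  -- Because `m` is positive there is a first prime; it contains the nonzero element `a` of `I`,
  -- hence is maximal.
  em = excludedMiddle P₀ (proj₂ (proj₂ (proj₂ dedekind)) P₀ P₀-prime
    (a , divides⇒⊑ P₀ I (proj₁ (proj₂ (props Fin.zero))) a a∈I , a≉0))

  open Components em dedekind I I-nonzero finite m primes
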